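{- Let $k \geq 2$ and let $n_1,\ldots,n_k$ be positive integers. Then the equitable chromatic threshold of $K_{n_1,\ldots,n_k}$ is $p(n_1+\cdots+n_k: n_1,\ldots,n_k)$.
   Context: All graphs are finite, undirected and simple. $K_{n_1,\ldots,n_k}$ denotes the complete $k$-partite graph whose partite sets $X_1,\ldots,X_k$ have sizes $|X_i|=n_i$ for $1\le i\le k$ (two vertices are adjacent if and only if they lie in different partite sets). An equitable $q$-coloring of a graph is a proper vertex coloring with $q$ colors such that the sizes of every two of the $q$ color classes differ by at most $1$ (color classes may be empty, so every graph on $N$ vertices has an equitable $q$-coloring for every $q\ge N$). The equitable chromatic threshold of a graph $G$ is the minimum positive integer $p$ such that $G$ has an equitable $q$-coloring for every integer $q\geq p$. Definition of $p(q: n_1,\ldots,n_k)$: assume that $K_{n_1,\ldots,n_k}$ has an equitable $q$-coloring (this is the case for $q=n_1+\cdots+n_k$). Let $d$ be the minimum integer with $d \geq \lceil (n_1+\cdots+n_k)/q \rceil$ such that at least one of the following holds: (i) there are distinct indices $i$ and $j$ such that neither $n_i$ nor $n_j$ is divisible by $d$; or (ii) there is an index $j$ with $n_j/\lfloor n_j/d\rfloor > d+1$, where the quotient is a real (rational) quotient, and is read as $+\infty$ when $\lfloor n_j/d\rfloor = 0$ (so (ii) holds whenever $d>n_j$ for some $j$). Then $p(q: n_1,\ldots,n_k) = \lceil n_1/d \rceil+\cdots+\lceil n_k/d \rceil$. -}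

module Defs where

open import Data.Fin using (Fin; zero; suc; splitAt; _≟_)
open import Data.Fin.Subset using (Subset; ∣_∣)
import Data.Integer as ℤ
open import Data.Nat using (ℕ; zero; suc; _+_; _∸_; _/_; _≤_; _<_; ∣_-_∣; NonZero)
open import Data.Nat.Divisibility using (_∣_)
open import Data.Product using (∃-syntax; _×_)
import Data.Rational.Unnormalised as ℚ
open import Data.Sum using (_⊎_; [_,_])
open import Data.Unit using (⊤)
open import Data.Vec using (tabulate)
open import Data.Vec.Functional using (Vector; foldr; head; tail)
open import Function using (const; _∘_)
open import Level using (0ℓ)
open import Relation.Binary using (Rel; Symmetric; Irreflexive)
open import Relation.Binary.PropositionalEquality using (_≡_; _≢_; refl; sym)
open import Relation.Nullary using (¬_; does)

sum : ∀ {k} → Vector ℕ k → ℕ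
sum = foldr _+_ 0

⌈_/_⌉ : (m d : ℕ) → .{{_ : NonZero d}} → ℕ
⌈ m / d ⌉ = (m + (d ∸ 1)) / d

IsMinimum : (ℕ → Set) → ℕ → Set
IsMinimum P m = P m × (∀ m′ → P m′ → m ≤ m′)

record Graph : Set₁ where
  field
    order  : ℕ
    Adj    : Rel (Fin order) 0ℓ
    symm   : Symmetric Adj
    irrefl : Irreflexive _≡_ Adj

-- The vertices of K_{n₁,…,n_k} are 0, …, n₁ + ⋯ + n_k − 1; the first n₁ of
-- them form X₁, the next n₂ form X₂, and so on.
part : ∀ {k} (n : Vector ℕ k) → Fin (sum n) → Fin k
part {suc k} n v = [ const zero , suc ∘ part (tail n) ] (splitAt (head n) v)

completeMultipartite : ∀ {k} → Vector ℕ k → Graph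
completeMultipartite n = record
  { order  = sum n
  ; Adj    = λ u v → part n u ≢ part n v
  ; symm   = λ u≁v eq → u≁v (sym eq)
  ; irrefl = λ where refl u≁u → u≁u refl
  }

colorClass : ∀ {N q} → (Fin N → Fin q) → Fin q → Subset N
colorClass c a = tabulate (λ v → does (c v ≟ a))

module _ (G : Graph) where
  open Graph G

  record EquitableColoring (q : ℕ) : Set where
    field
      color     : Fin order → Fin q
      proper    : ∀ u v → Adj u v → color u ≢ color v
      equitable : ∀ a b → ∣ ∣ colorClass color a ∣ - ∣ colorClass color b ∣ ∣ ≤ 1

  IsEquitableChromaticThreshold : ℕ → Set
  IsEquitableChromaticThreshold =
    IsMinimum λ p → 0 < p × (∀ q → p ≤ q → EquitableColoring q)

-- m / f > b as rational numbers, where m / 0 is read as +∞.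
QuotientExceeds : (m f b : ℕ) → Set
QuotientExceeds m zero    b = ⊤
QuotientExceeds m (suc f) b = (ℤ.+ m ℚ./ suc f) ℚ.> (ℤ.+ b ℚ./ 1)

module _ {k : ℕ} (n : Vector ℕ k) where

  TwoNonMultiples : ℕ → Set
  TwoNonMultiples d = ∃[ i ] ∃[ j ] (i ≢ j × ¬ (d ∣ n i) × ¬ (d ∣ n j))

  LargeQuotient : (d : ℕ) → .{{_ : NonZero d}} → Set
  LargeQuotient d = ∃[ j ] QuotientExceeds (n j) (n j / d) (d + 1)

  -- When the nᵢ are positive, d ≥ ⌈(n₁ + ⋯ + n_k)/q⌉ already forces d ≥ 1;
  -- the field d≢0 is there so that one can divide by d.
  record Admissible (q : ℕ) .{{_ : NonZero q}} (d : ℕ) : Set where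
    field
      {{d≢0}}     : NonZero d
      lowerBound  : ⌈ sum n / q ⌉ ≤ d
      alternative : TwoNonMultiples d ⊎ LargeQuotient d

  -- Is-p q p says that p(q : n₁, …, n_k) is defined and equal to p.
  -- When the nᵢ are positive, q≢0 follows from colorable.
  record Is-p (q p : ℕ) : Set where
    field
      {{q≢0}}   : NonZero q
      colorable : EquitableColoring (completeMultipartite n) q
      d         : ℕ
      {{d≢0}}   : NonZero d
      minimum   : IsMinimum (Admissible q) d
      value     : p ≡ sum (λ i → ⌈ n i / d ⌉)

{-# OPTIONS --safe #-}
module Submission where

-- Color classes of sizes h and h + 1 split X_i into a_i classes if and only if
-- h a_i ≤ n_i ≤ (h + 1) a_i, that is ⌈n_i/(h + 1)⌉ ≤ a_i ≤ ⌊n_i/h⌋.  So if these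
-- bounds are consistent for each i, every q between Σ ⌈n_i/(h + 1)⌉ and Σ ⌊n_i/h⌋
-- is attained.  For h < d the failure of (ii) gives consistency and the failure of
-- (i) leaves no gap between the intervals for h and h − 1; together they cover
-- everything from p = Σ ⌈n_i/d⌉ on.
-- Conversely, let q = p − 1.  Class sizes at most d force q ≥ p, so all are at
-- least d and a_i ≤ ⌊n_i/d⌋.  Under (i) this gives q ≤ p − 2.  Under (ii) sizes d
-- and d + 1 cannot fill X_j, so all sizes are at least d + 1; then
-- a_i ≤ ⌊n_i/(d + 1)⌋ < ⌈n_i/d⌉ for all i, and again q ≤ p − 2, as k ≥ 2.

open import Defs
import Algebra.Properties.Semiring.Sum
open import Data.Bool using (true; false; if_then_else_)
open import Data.Empty using (⊥; ⊥-elim)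
open import Data.Fin using (Fin; zero; suc; splitAt; _≟_; _↑ˡ_; _↑ʳ_)
open import Data.Fin.Properties
  using (any?; all?; ¬∀⟶∃¬; splitAt-↑ˡ; splitAt-↑ʳ; splitAt⁻¹-↑ˡ; splitAt⁻¹-↑ʳ; suc-injective)
open import Data.Fin.Subset using (∣_∣)
import Data.Integer as ℤ
import Data.Integer.Properties as ℤ
open import Data.Nat
  using (ℕ; zero; suc; _+_; _*_; _∸_; _/_; _≤_; _<_; _≤?_; _<?_; ∣_-_∣; NonZero;
         z≤n; s≤s; s≤s⁻¹; >-nonZero; >-nonZero⁻¹)
open import Data.Nat.Divisibility using (_∣_; _∣?_; divides)
open import Data.Nat.DivMod using (m/n*n≤m; m/n*n≡m; m<n*o⇒m/o<n; m*n/n≡m; /-monoˡ-≤; m<n⇒m/n≡0; n/1≡n)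
open import Data.Nat.Properties hiding (_≟_; suc-injective)
open import Data.Product using (∃-syntax; _×_; _,_; proj₁; proj₂)
import Data.Rational.Unnormalised as ℚ
open import Data.Sum using (_⊎_; inj₁; inj₂; [_,_]; [_,_]′)
open import Data.Unit using (tt)
open import Data.Vec.Functional using (Vector; tail; _∷_)
open import Function using (const; _∘_; id)
open import Relation.Binary.PropositionalEquality
  using (_≡_; _≢_; _≗_; refl; sym; trans; cong; cong₂; subst; subst₂; module ≡-Reasoning)
open import Relation.Nullary using (¬_; Dec; yes; no; does)
open import Relation.Nullary.Decidable using (_⊎-dec_; _×-dec_; ¬?; map′; decidable-stable)

module Σℕ = Algebra.Properties.Semiring.Sum +-*-semiring

private
  variable
    k l q m N : ℕ

-- Sums

sum-mono : {f g : Vector ℕ k} → (∀ i → f i ≤ g i) → sum f ≤ sum g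
sum-mono {zero}  f≤g = z≤n
sum-mono {suc k} f≤g = +-mono-≤ (f≤g zero) (sum-mono (f≤g ∘ suc))

sum-const : ∀ k x → sum {k} (const x) ≡ k * x
sum-const zero    x = refl
sum-const (suc k) x = cong (x +_) (sum-const k x)

sum-+ : ∀ m (f : Vector ℕ (m + l)) → sum f ≡ sum (λ x → f (x ↑ˡ l)) + sum (λ y → f (m ↑ʳ y))
sum-+ zero    f = refl
sum-+ (suc m) f = trans (cong (f zero +_) (sum-+ m (f ∘ suc))) (sym (+-assoc (f zero) _ _))

term≤sum : (f : Vector ℕ k) → ∀ i → f i ≤ sum f
term≤sum f zero    = m≤m+n _ _
term≤sum f (suc i) = ≤-trans (term≤sum (tail f) i) (m≤n+m _ _)

sum-strict : {f g : Vector ℕ k} → (∀ i → f i ≤ g i) → ∀ i → f i < g i → sum f < sum g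
sum-strict f≤g zero    f<g = +-mono-<-≤ f<g (sum-mono (f≤g ∘ suc))
sum-strict f≤g (suc i) f<g = +-mono-≤-< (f≤g zero) (sum-strict (f≤g ∘ suc) i f<g)

-- Each strict index contributes 1, so two distinct ones give a gap of 2. This is what pushes the
-- number of colors below `p − 1`.
sum-strict₂ : {f g : Vector ℕ k} → (∀ i → f i ≤ g i) → ∀ i j → i ≢ j →
              f i < g i → f j < g j → suc (sum f) < sum g
sum-strict₂ f≤g zero zero i≢j _ _ = ⊥-elim (i≢j refl)
sum-strict₂ {f = f} {g} f≤g zero (suc j) _ p q =
  subst (_≤ sum g) (cong suc (+-suc (f zero) _)) (+-mono-≤ p (sum-strict (f≤g ∘ suc) j q))
sum-strict₂ {f = f} {g} f≤g (suc i) zero _ p q =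
  subst (_≤ sum g) (cong suc (+-suc (f zero) _)) (+-mono-≤ q (sum-strict (f≤g ∘ suc) i p))
sum-strict₂ {f = f} {g} f≤g (suc i) (suc j) i≢j p q =
  subst (_≤ sum g) (trans (+-suc (f zero) _) (cong suc (+-suc (f zero) _)))
    (+-mono-≤ (f≤g zero) (sum-strict₂ (f≤g ∘ suc) i j (i≢j ∘ cong suc) p q))

-- At most one index has `f` above `g`, and there only by 1. It closes the gap between consecutive
-- intervals of attainable `q`.
sum-≤-suc : {f g : Vector ℕ k} → (∀ i → f i ≤ suc (g i)) →
            (∀ i j → i ≢ j → f i ≤ g i ⊎ f j ≤ g j) → sum f ≤ suc (sum g)
sum-≤-suc {zero}  _ _ = z≤n
sum-≤-suc {suc k} {f} {g} f≤1+g one with f zero ≤? g zero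
... | yes p = subst (sum f ≤_) (+-suc (g zero) _)
      (+-mono-≤ p (sum-≤-suc (f≤1+g ∘ suc) (λ i j i≢j → one (suc i) (suc j) (i≢j ∘ suc-injective))))
... | no ¬p = +-mono-≤ (f≤1+g zero) (sum-mono λ j → [ ⊥-elim ∘ ¬p , id ] (one zero (suc j) λ ()))

-- A greedy choice: the head takes its lower bound as long as the tail can absorb the rest;
-- otherwise the tail is filled to its upper bounds and the head takes what remains.
interpolate : {L U : Vector ℕ k} → (∀ i → L i ≤ U i) → ∀ n → sum L ≤ n → n ≤ sum U →
              ∃[ s ] (∀ i → L i ≤ s i × s i ≤ U i) × sum s ≡ n
interpolate {zero}  L≤U n _ n≤0 = (λ ()) , (λ ()) , sym (n≤0⇒n≡0 n≤0)
interpolate {suc k} {L} {U} L≤U n ΣL≤n n≤ΣU with n ≤? L zero + sum (tail U)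
... | yes p =
  let L₀≤n = ≤-trans (m≤m+n (L zero) _) ΣL≤n
      s , b , eq = interpolate (L≤U ∘ suc) (n ∸ L zero)
                     (subst (_≤ n ∸ L zero) (m+n∸m≡n (L zero) _) (∸-monoˡ-≤ (L zero) ΣL≤n))
                     (subst (n ∸ L zero ≤_) (m+n∸m≡n (L zero) _) (∸-monoˡ-≤ (L zero) p))
  in L zero ∷ s
   , (λ where zero    → ≤-refl , L≤U zero
              (suc i) → b i)
   , trans (cong (L zero +_) eq) (m+[n∸m]≡n L₀≤n)
... | no ¬p =
  let ΣU = sum (tail U)
      p  = <⇒≤ (≰⇒> ¬p)
  in (n ∸ ΣU) ∷ tail U
   , (λ where zero    → subst (_≤ n ∸ ΣU) (m+n∸n≡m (L zero) ΣU) (∸-monoˡ-≤ ΣU p)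
                      , subst (n ∸ ΣU ≤_) (m+n∸n≡m (U zero) ΣU) (∸-monoˡ-≤ ΣU n≤ΣU)
              (suc i) → L≤U (suc i) , ≤-refl)
   , m∸n+n≡m (≤-trans (m≤n+m ΣU (L zero)) p)

-- Fibres of maps between finite sets

𝟙 : Fin q → Fin q → ℕ
𝟙 x y = if does (x ≟ y) then 1 else 0

fibre : (Fin N → Fin q) → Fin q → ℕ
fibre c a = sum λ v → 𝟙 (c v) a

∣colorClass∣≡fibre : (c : Fin N → Fin q) → ∀ a → ∣ colorClass c a ∣ ≡ fibre c a
∣colorClass∣≡fibre {zero}  c a = refl
∣colorClass∣≡fibre {suc N} c a with does (c zero ≟ a)
... | true  = cong suc (∣colorClass∣≡fibre (c ∘ suc) a)
... | false = ∣colorClass∣≡fibre (c ∘ suc) a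

𝟙-↑ˡ : ∀ l (x y : Fin m) → 𝟙 (x ↑ˡ l) (y ↑ˡ l) ≡ 𝟙 x y
𝟙-↑ˡ l zero    zero    = refl
𝟙-↑ˡ l zero    (suc y) = refl
𝟙-↑ˡ l (suc x) zero    = refl
𝟙-↑ˡ l (suc x) (suc y) = 𝟙-↑ˡ l x y

𝟙-↑ʳ : ∀ m (x y : Fin l) → 𝟙 (m ↑ʳ x) (m ↑ʳ y) ≡ 𝟙 x y
𝟙-↑ʳ zero    x y = refl
𝟙-↑ʳ (suc m) x y = 𝟙-↑ʳ m x y

𝟙-↑ˡ-↑ʳ : (x : Fin m) (y : Fin l) → 𝟙 (x ↑ˡ l) (m ↑ʳ y) ≡ 0
𝟙-↑ˡ-↑ʳ zero    y = refl
𝟙-↑ˡ-↑ʳ (suc x) y = 𝟙-↑ˡ-↑ʳ x y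

𝟙-↑ʳ-↑ˡ : (x : Fin m) (y : Fin l) → 𝟙 (m ↑ʳ y) (x ↑ˡ l) ≡ 0
𝟙-↑ʳ-↑ˡ zero    y = refl
𝟙-↑ʳ-↑ˡ (suc x) y = 𝟙-↑ʳ-↑ˡ x y

sum-𝟙-* : (x : Fin q) (t : Vector ℕ q) → sum (λ a → 𝟙 x a * t a) ≡ t x
sum-𝟙-* {suc q} zero    t = trans (cong₂ _+_ (*-identityˡ (t zero)) (Σℕ.sum-replicate-zero q)) (+-identityʳ _)
sum-𝟙-* {suc q} (suc x) t = sum-𝟙-* x (t ∘ suc)

-- Double counting: each `v` lies in exactly one fibre of `f`, so its indicator expands by
-- `sum-𝟙-*`, and the two sums are exchanged.
fibre-∘ : (f : Fin N → Fin q) (g : Fin q → Fin k) → ∀ i →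
          fibre (g ∘ f) i ≡ sum (λ a → fibre f a * 𝟙 (g a) i)
fibre-∘ f g i = begin
  sum (λ v → 𝟙 (g (f v)) i)                       ≡⟨ Σℕ.sum-cong-≗ (λ v → sum-𝟙-* (f v) _) ⟨
  sum (λ v → sum (λ a → 𝟙 (f v) a * 𝟙 (g a) i))   ≡⟨ Σℕ.∑-comm (λ v a → 𝟙 (f v) a * 𝟙 (g a) i) ⟩
  sum (λ a → sum (λ v → 𝟙 (f v) a * 𝟙 (g a) i))
    ≡⟨ Σℕ.sum-cong-≗ (λ a → Σℕ.*-distribʳ-sum (𝟙 (g a) i) (λ v → 𝟙 (f v) a)) ⟨
  sum (λ a → fibre f a * 𝟙 (g a) i)               ∎
  where open ≡-Reasoning

sum-fibre : (f : Fin N → Fin q) → sum (fibre f) ≡ N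
sum-fibre {N} {q} f = begin
  sum (λ a → sum (λ v → 𝟙 (f v) a))      ≡⟨ Σℕ.∑-comm (λ a v → 𝟙 (f v) a) ⟩
  sum (λ v → sum (λ a → 𝟙 (f v) a))
    ≡⟨ Σℕ.sum-cong-≗ (λ v → Σℕ.sum-cong-≗ λ a → *-identityʳ (𝟙 (f v) a)) ⟨
  sum (λ v → sum (λ a → 𝟙 (f v) a * 1))  ≡⟨ Σℕ.sum-cong-≗ (λ v → sum-𝟙-* (f v) (const 1)) ⟩
  sum {N} (const 1)                      ≡⟨ sum-const N 1 ⟩
  N * 1                                  ≡⟨ *-identityʳ N ⟩
  N                                      ∎
  where open ≡-Reasoning

fibre-∘-≤ : (f : Fin N → Fin q) (g : Fin q → Fin k) {h : ℕ} → (∀ a → fibre f a ≤ h) →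
            ∀ i → fibre (g ∘ f) i ≤ h * fibre g i
fibre-∘-≤ f g {h} f≤h i rewrite fibre-∘ f g i | Σℕ.*-distribˡ-sum h (λ a → 𝟙 (g a) i) =
  sum-mono λ a → *-monoˡ-≤ _ (f≤h a)

fibre-∘-≥ : (f : Fin N → Fin q) (g : Fin q → Fin k) {h : ℕ} → (∀ a → h ≤ fibre f a) →
            ∀ i → h * fibre g i ≤ fibre (g ∘ f) i
fibre-∘-≥ f g {h} h≤f i rewrite fibre-∘ f g i | Σℕ.*-distribˡ-sum h (λ a → 𝟙 (g a) i) =
  sum-mono λ a → *-monoˡ-≤ _ (h≤f a)

infixr 5 _⊕_
_⊕_ : ∀ {m l a b} → (Fin m → Fin a) → (Fin l → Fin b) → Fin (m + l) → Fin (a + b)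
_⊕_ {m} {a = a} {b} f g v = [ (λ x → f x ↑ˡ b) , (λ y → a ↑ʳ g y) ] (splitAt m v)

fibre-⊕ : ∀ {m l a b} (f : Fin m → Fin a) (g : Fin l → Fin b) → ∀ c →
          fibre (f ⊕ g) c ≡ [ fibre f , fibre g ] (splitAt a c)
fibre-⊕ {m} {l} {a} {b} f g c = begin
  fibre (f ⊕ g) c                                                     ≡⟨ sum-+ m _ ⟩
  sum (λ x → 𝟙 ((f ⊕ g) (x ↑ˡ l)) c) + sum (λ y → 𝟙 ((f ⊕ g) (m ↑ʳ y)) c)
    ≡⟨ cong₂ _+_ (Σℕ.sum-cong-≗ λ x → cong (λ z → 𝟙 ([ _ , _ ] z) c) (splitAt-↑ˡ m x l))
                 (Σℕ.sum-cong-≗ λ y → cong (λ z → 𝟙 ([ _ , _ ] z) c) (splitAt-↑ʳ m l y)) ⟩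
  sum (λ x → 𝟙 (f x ↑ˡ b) c) + sum (λ y → 𝟙 (a ↑ʳ g y) c)             ≡⟨ by-side ⟩
  [ fibre f , fibre g ] (splitAt a c)                                 ∎
  where
  open ≡-Reasoning
  by-side : sum (λ x → 𝟙 (f x ↑ˡ b) c) + sum (λ y → 𝟙 (a ↑ʳ g y) c) ≡
            [ fibre f , fibre g ] (splitAt a c)
  by-side with splitAt a c in eq
  ... | inj₁ x′ rewrite sym (splitAt⁻¹-↑ˡ eq) =
    trans (cong₂ _+_ (Σℕ.sum-cong-≗ λ x → 𝟙-↑ˡ b (f x) x′)
                     (trans (Σℕ.sum-cong-≗ λ y → 𝟙-↑ʳ-↑ˡ x′ (g y)) (Σℕ.sum-replicate-zero l)))
          (+-identityʳ _)
  ... | inj₂ y′ rewrite sym (splitAt⁻¹-↑ʳ {m = a} eq) =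
    cong₂ _+_ (trans (Σℕ.sum-cong-≗ λ x → 𝟙-↑ˡ-↑ʳ (f x) y′) (Σℕ.sum-replicate-zero m))
              (Σℕ.sum-cong-≗ λ y → 𝟙-↑ʳ a (g y) y′)

fibre-part : (n : Vector ℕ k) → ∀ i → fibre (part n) i ≡ n i
fibre-part {suc k} n zero =
  -- By computation `part n` is `const zero ⊕ part (tail n)`, the first summand having a one-element
  -- codomain.
  trans (fibre-⊕ {n zero} {sum (tail n)} {1} {k} (const zero) (part (tail n)) zero)
        (trans (sum-const (n zero) 1) (*-identityʳ _))
fibre-part {suc k} n (suc i) =
  trans (fibre-⊕ {n zero} {sum (tail n)} {1} {k} (const zero) (part (tail n)) (suc i))
        (fibre-part (tail n) i)

-- Equitable colorings from numerical data

Balanced : ℕ → (Fin N → Fin q) → Set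
Balanced h c = ∀ a → h ≤ fibre c a × fibre c a ≤ suc h

-- Class sizes `s` between `h` and `suc h` with total `n` exist by interpolation. The block map
-- `part s` then serves as the coloring.
balanced : ∀ {h a n} → a * h ≤ n → n ≤ a * suc h → ∃[ c ] Balanced {n} {a} h c
balanced {h} {a} {n} lo hi
  with s , b , refl ← interpolate {a} {const h} {const (suc h)} (λ _ → n≤1+n h) n
                        (subst (_≤ n) (sym (sum-const a h)) lo)
                        (subst (n ≤_) (sym (sum-const a (suc h))) hi)
  = part s , λ x → subst (λ z → h ≤ z × z ≤ suc h) (sym (fibre-part s x)) (b x)

balanced-⊕ : ∀ {m l a b h} (f : Fin m → Fin a) (g : Fin l → Fin b) →
             Balanced h f → Balanced h g → Balanced h (f ⊕ g)
balanced-⊕ {a = a} f g bf bg x rewrite fibre-⊕ f g x with splitAt a x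
... | inj₁ y = bf y
... | inj₂ z = bg z

-- The palette `Fin (sum a)` is cut into one block of `a i` colors per part, so `part a` recovers
-- from a color the part using it. The last component yields properness.
balanced-parts : ∀ {h} (a n : Vector ℕ k) → (∀ i → a i * h ≤ n i) → (∀ i → n i ≤ a i * suc h) →
                 ∃[ c ] Balanced {sum n} {sum a} h c × part a ∘ c ≗ part n
balanced-parts {zero}  a n lo hi = (λ ()) , (λ ()) , λ ()
balanced-parts {suc k} {h} a n lo hi
  with f , bf          ← balanced {h} {a zero} {n zero} (lo zero) (hi zero)
     | g , bg , part-g ← balanced-parts {k} {h} (tail a) (tail n) (lo ∘ suc) (hi ∘ suc)
  = f ⊕ g , balanced-⊕ f g bf bg , part-⊕
  where
  part-⊕ : part a ∘ (f ⊕ g) ≗ part n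
  part-⊕ v with splitAt (n zero) v
  ... | inj₁ x rewrite splitAt-↑ˡ (a zero) (f x) (sum (tail a)) = refl
  ... | inj₂ y rewrite splitAt-↑ʳ (a zero) (sum (tail a)) (g y) = cong suc (part-g y)

∣-∣≤1 : ∀ {h x y} → h ≤ x × x ≤ suc h → h ≤ y × y ≤ suc h → ∣ x - y ∣ ≤ 1
∣-∣≤1 {h} {x} {y} (h≤x , x≤h′) (h≤y , y≤h′) with ≤-total x y
... | inj₁ x≤y = subst (_≤ 1) (sym (m≤n⇒∣m-n∣≡n∸m x≤y))
                   (m≤n+o⇒m∸n≤o _ _ (≤-trans y≤h′ (subst (suc h ≤_) (+-comm 1 x) (s≤s h≤x))))
... | inj₂ y≤x = subst (_≤ 1) (sym (m≤n⇒∣n-m∣≡n∸m y≤x))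
                   (m≤n+o⇒m∸n≤o _ _ (≤-trans x≤h′ (subst (suc h ≤_) (+-comm 1 y) (s≤s h≤y))))

coloring : ∀ {h} (a n : Vector ℕ k) → (∀ i → a i * h ≤ n i) → (∀ i → n i ≤ a i * suc h) →
           sum a ≡ q → EquitableColoring (completeMultipartite n) q
coloring a n lo hi refl with c , bal , owner ← balanced-parts a n lo hi = record
  { color     = c
  ; proper    = λ u v u≁v eq → u≁v (trans (sym (owner u)) (trans (cong (part a) eq) (owner v)))
  ; equitable = λ x y → subst₂ (λ s t → ∣ s - t ∣ ≤ 1)
                  (sym (∣colorClass∣≡fibre c x)) (sym (∣colorClass∣≡fibre c y)) (∣-∣≤1 (bal x) (bal y))
  }

-- Numerical data from equitable colorings

-- A single value above `d` keeps every other value, being within 1 of it, at `d` or more.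
all-≤⊎all-≥ : (f : Vector ℕ q) → (∀ x y → ∣ f x - f y ∣ ≤ 1) →
              ∀ d → (∀ x → f x ≤ d) ⊎ (∀ x → d ≤ f x)
all-≤⊎all-≥ {q} f near d with all? (λ x → f x ≤? d)
... | yes p = inj₁ p
... | no ¬p with x , fx≰d ← ¬∀⟶∃¬ q _ (λ x → f x ≤? d) ¬p =
  inj₂ λ y → s≤s⁻¹ (≤-trans (≰⇒> fx≰d)
    (≤-trans (m≤n+∣m-n∣ (f x) (f y))
             (subst (f y + ∣ f x - f y ∣ ≤_) (+-comm (f y) 1) (+-monoʳ-≤ (f y) (near x y)))))

module _ {n : Vector ℕ k} (i₀ : Fin k) (C : EquitableColoring (completeMultipartite n) q) where
  open EquitableColoring C

  -- Empty color classes are assigned to the part i₀.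
  owner : Fin q → Fin k
  owner x with any? (λ v → color v ≟ x)
  ... | yes (v , _) = part n v
  ... | no _        = i₀

  owner-color : owner ∘ color ≗ part n
  owner-color u with any? (λ v → color v ≟ color u)
  -- Adjacency is a negated equality, so properness gives only a double negation, removed by
  -- decidability.
  ... | yes (v , eq) = decidable-stable (part n v ≟ part n u) (λ v≁u → proper v u v≁u eq)
  ... | no ¬p        = ⊥-elim (¬p (u , refl))

  fibre-owner-color : ∀ i → fibre (owner ∘ color) i ≡ n i
  fibre-owner-color i =
    trans (Σℕ.sum-cong-≗ λ v → cong (λ x → 𝟙 x i) (owner-color v)) (fibre-part n i)

  -- Here `a i` counts the colors owned by part `i`. The lower bound uses the dichotomy twice, at
  -- `d` and at `suc d`.
  class-counts : ∃[ a ] sum a ≡ q × ∀ d → (∀ i → n i ≤ d * a i) ⊎ (∀ i → d * a i ≤ n i)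
  class-counts = fibre owner , sum-fibre owner , λ d →
    [ (λ hi → inj₁ λ i → subst (_≤ d * fibre owner i) (fibre-owner-color i) (fibre-∘-≤ color owner hi i))
    , (λ lo → inj₂ λ i → subst (d * fibre owner i ≤_) (fibre-owner-color i) (fibre-∘-≥ color owner lo i))
    ]′ (all-≤⊎all-≥ (fibre color) near d)
    where
    near : ∀ x y → ∣ fibre color x - fibre color y ∣ ≤ 1
    near x y = subst₂ (λ s t → ∣ s - t ∣ ≤ 1) (∣colorClass∣≡fibre color x) (∣colorClass∣≡fibre color y)
                 (equitable x y)

-- Rounded quotients

module _ (d : ℕ) .{{_ : NonZero d}} where

  ≤-/ : ∀ {a m} → d * a ≤ m → a ≤ m / d
  ≤-/ {a} {m} p = subst (_≤ m / d) (trans (cong (_/ d) (*-comm d a)) (m*n/n≡m a d)) (/-monoˡ-≤ d p)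

  ⌈/⌉-≤ : ∀ {a m} → m ≤ d * a → ⌈ m / d ⌉ ≤ a
  ⌈/⌉-≤ {a} {m} p = s≤s⁻¹ (m<n*o⇒m/o<n {n = suc a} (begin-strict
    m + (d ∸ 1)       <⟨ +-mono-≤-< p (∸-monoʳ-< {d} (s≤s z≤n) (>-nonZero⁻¹ d)) ⟩
    d * a + d         ≡⟨ +-comm (d * a) d ⟩
    d + d * a         ≡⟨ cong (d +_) (*-comm d a) ⟩
    d + a * d         ∎))
    where open ≤-Reasoning

  -- Were `d * ⌈ m / d ⌉` below `m`, the numerator `m + (d ∸ 1)` would contain one more multiple of
  -- `d` than its quotient allows.
  ≤-*⌈/⌉ : ∀ m → m ≤ d * ⌈ m / d ⌉
  ≤-*⌈/⌉ m = ≮⇒≥ λ r<m → n≮n ⌈ m / d ⌉ (≤-/ (begin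
    d * suc ⌈ m / d ⌉              ≡⟨ *-suc d _ ⟩
    d + d * ⌈ m / d ⌉              ≡⟨ cong (_+ d * ⌈ m / d ⌉) (m+[n∸m]≡n (>-nonZero⁻¹ d)) ⟨
    suc (d ∸ 1) + d * ⌈ m / d ⌉    ≡⟨ cong suc (+-comm (d ∸ 1) _) ⟩
    suc (d * ⌈ m / d ⌉) + (d ∸ 1)  ≤⟨ +-monoˡ-≤ (d ∸ 1) r<m ⟩
    m + (d ∸ 1)                    ∎))
    where open ≤-Reasoning

  /≤⌈/⌉ : ∀ m → m / d ≤ ⌈ m / d ⌉
  /≤⌈/⌉ m = /-monoˡ-≤ d (m≤m+n m _)

  ⌈/⌉≤1+/ : ∀ m → ⌈ m / d ⌉ ≤ suc (m / d)
  ⌈/⌉≤1+/ m = ⌈/⌉-≤ (<⇒≤ (≰⇒> λ p → n≮n _ (≤-/ p)))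

  ∣⇒⌈/⌉≤/ : ∀ {m} → d ∣ m → ⌈ m / d ⌉ ≤ m / d
  ∣⇒⌈/⌉≤/ {m} d∣m = ⌈/⌉-≤ (≤-reflexive (trans (sym (m/n*n≡m d∣m)) (*-comm _ d)))

  ∤⇒/<⌈/⌉ : ∀ {m} → ¬ d ∣ m → m / d < ⌈ m / d ⌉
  ∤⇒/<⌈/⌉ {m} d∤m = ≰⇒> λ p → d∤m (divides (m / d) (≤-antisym
    (≤-trans (≤-*⌈/⌉ m) (≤-trans (*-monoʳ-≤ d p) (≤-reflexive (*-comm d _))))
    (m/n*n≤m m d)))

  -- Otherwise `x = m / suc d` satisfies `suc d * x ≤ m ≤ d * x`, which forces `x = 0` and then
  -- `m = 0`.
  /suc<⌈/⌉ : ∀ {m} → 0 < m → m / suc d < ⌈ m / d ⌉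
  /suc<⌈/⌉ {m} 0<m = ≰⇒> λ p → <⇒≱ (pos p) (+-cancelʳ-≤ (d * (m / suc d)) _ 0 (begin
    m / suc d + d * (m / suc d)  ≡⟨ *-comm (suc d) (m / suc d) ⟩
    m / suc d * suc d            ≤⟨ m/n*n≤m m (suc d) ⟩
    m                            ≤⟨ ≤-*⌈/⌉ m ⟩
    d * ⌈ m / d ⌉                ≤⟨ *-monoʳ-≤ d p ⟩
    d * (m / suc d)              ∎))
    where
    open ≤-Reasoning
    pos : ⌈ m / d ⌉ ≤ m / suc d → 0 < m / suc d
    pos p = n≢0⇒n>0 λ eq → <⇒≱ 0<m (begin
      m                ≤⟨ ≤-*⌈/⌉ m ⟩
      d * ⌈ m / d ⌉    ≤⟨ *-monoʳ-≤ d (≤-trans p (≤-reflexive eq)) ⟩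
      d * 0            ≡⟨ *-zeroʳ d ⟩
      0                ∎)

sum-⌈/1⌉ : (n : Vector ℕ k) → sum (λ i → ⌈ n i / 1 ⌉) ≡ sum n
sum-⌈/1⌉ {zero}  n = refl
sum-⌈/1⌉ {suc k} n = cong₂ _+_ (trans (n/1≡n _) (+-identityʳ _)) (sum-⌈/1⌉ (tail n))

-- The quotient condition over the integers, and least witnesses

exceeds⇒< : ∀ {m} f {b} → 0 < m → QuotientExceeds m f b → b * f < m
-- The reading +∞ at `f = 0` agrees with `b * 0 < m`, since `m` is positive.
exceeds⇒< {m} zero {b} 0<m _ = subst (_< m) (sym (*-zeroʳ b)) 0<m
exceeds⇒< {m} (suc f) {b} _ (ℚ.*<* p) =
  ℤ.drop‿+<+ (subst₂ ℤ._<_ (sym (ℤ.pos-* b (suc f))) (ℤ.*-identityʳ (ℤ.+ m)) p)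

<⇒exceeds : ∀ {m} f {b} → b * f < m → QuotientExceeds m f b
<⇒exceeds zero _ = tt
<⇒exceeds {m} (suc f) {b} p =
  ℚ.*<* (subst₂ ℤ._<_ (ℤ.pos-* b (suc f)) (sym (ℤ.*-identityʳ (ℤ.+ m))) (ℤ.+<+ p))

least : {P : ℕ → Set} → (∀ m → Dec (P m)) → ∀ m → P m → ∃[ l ] IsMinimum P l
least P? m Pm with P? zero
... | yes P0 = zero , P0 , λ _ _ → z≤n
least P? zero    Pm | no ¬P0 = ⊥-elim (¬P0 Pm)
least P? (suc m) Pm | no ¬P0 with l , Pl , min ← least (P? ∘ suc) m Pm =
  suc l , Pl , λ where zero    P0 → ⊥-elim (¬P0 P0)
                       (suc j) Pj → s≤s (min j Pj)

-- The threshold of a complete multipartite graph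

module _ {k} (n : Vector ℕ (suc (suc k))) (n>0 : ∀ i → 0 < n i) where

  Alternative : (d : ℕ) .{{_ : NonZero d}} → Set
  Alternative d = TwoNonMultiples n d ⊎ LargeQuotient n d

  alternative? : ∀ d .{{_ : NonZero d}} → Dec (Alternative d)
  alternative? d =
    any? (λ i → any? λ j → ¬? (i ≟ j) ×-dec ¬? (d ∣? n i) ×-dec ¬? (d ∣? n j))
    ⊎-dec
    any? (λ j → map′ (<⇒exceeds (n j / d)) (exceeds⇒< (n j / d) (n>0 j))
                  ((d + 1) * (n j / d) <? n j))

  -- Induction on `e`: class sizes `e` and `suc e` serve `q` up to the sum of the `n i / e`, and
  -- larger `q` are left to smaller classes. At `e = 0` the upper end is infinite.
  colorable : ∀ e → (∀ d .{{_ : NonZero d}} → d ≤ e → ¬ Alternative d) →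
              ∀ q → sum (λ i → ⌈ n i / suc e ⌉) ≤ q → EquitableColoring (completeMultipartite n) q
  colorable zero _ q Σ≤q
    -- Classes have size 0 or 1, so part `i` may own any number of colors from `n i` on; the cap
    -- `n i + q` only has to make the total reach `q`.
    with a , b , eq ← interpolate {L = n} {U = λ i → n i + q} (λ i → m≤m+n _ q) q
           (subst (_≤ q) (sum-⌈/1⌉ n) Σ≤q)
           (≤-trans (m≤n+m q (n zero)) (m≤m+n (n zero + q) _))
    = coloring {h = 0} a n (λ i → subst (_≤ n i) (sym (*-zeroʳ (a i))) z≤n)
        (λ i → subst (n i ≤_) (sym (*-identityʳ (a i))) (proj₁ (b i))) eq
  colorable (suc e) good q Σ≤q with q ≤? sum (λ i → n i / suc e)
  ... | no q≰ = colorable e (λ d d≤e → good d (m≤n⇒m≤1+n d≤e)) q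
                  (≤-trans (sum-≤-suc (λ i → ⌈/⌉≤1+/ (suc e) (n i)) one) (≰⇒> q≰))
    where
    one : ∀ i j → i ≢ j → ⌈ n i / suc e ⌉ ≤ n i / suc e ⊎ ⌈ n j / suc e ⌉ ≤ n j / suc e
    one i j i≢j with suc e ∣? n i | suc e ∣? n j
    ... | yes p | _     = inj₁ (∣⇒⌈/⌉≤/ (suc e) p)
    ... | no _  | yes p = inj₂ (∣⇒⌈/⌉≤/ (suc e) p)
    ... | no ¬p | no ¬q = ⊥-elim (good (suc e) ≤-refl (inj₁ (i , j , i≢j , ¬p , ¬q)))
  ... | yes q≤ =
    let a , b , eq = interpolate L≤U q Σ≤q q≤ in
    coloring {h = suc e} a n
      (λ i → ≤-trans (*-monoˡ-≤ (suc e) (proj₂ (b i))) (m/n*n≤m (n i) (suc e)))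
      (λ i → ≤-trans (≤-*⌈/⌉ (2 + e) (n i))
               (≤-trans (*-monoʳ-≤ (2 + e) (proj₁ (b i))) (≤-reflexive (*-comm (2 + e) (a i)))))
      eq
    where
    L≤U : ∀ i → ⌈ n i / 2 + e ⌉ ≤ n i / suc e
    -- Failure of (ii) at `suc e` reads `n i ≤ (2 + e) * (n i / suc e)`.
    L≤U i = ⌈/⌉-≤ (2 + e) (≮⇒≥ λ p → good (suc e) ≤-refl
      (inj₂ (i , <⇒exceeds (n i / suc e)
        (subst (λ z → z * (n i / suc e) < n i) (+-comm 1 (suc e)) p))))

  uncolorable : ∀ d .{{_ : NonZero d}} → Alternative d → ∀ q → sum (λ i → ⌈ n i / d ⌉) ≡ suc q →
                ¬ EquitableColoring (completeMultipartite n) q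
  uncolorable d alt q Σ≡ C with a , refl , bounds ← class-counts {n = n} zero C with bounds d
  ... | inj₁ n≤da = n≮n _ (subst (_≤ sum a) Σ≡ (sum-mono λ i → ⌈/⌉-≤ d (n≤da i)))
  ... | inj₂ da≤n with alt
  ...   | inj₁ (i , j , i≢j , d∤i , d∤j) =
    -- With `S` the sum of the `n i / d`, this combines `2 + S ≤ suc q` with `q ≤ S`.
    n≮n _ (≤-trans (subst (2 + sum (λ i → n i / d) ≤_) Σ≡
                     (sum-strict₂ (λ i → /≤⌈/⌉ d (n i)) i j i≢j (∤⇒/<⌈/⌉ d d∤i) (∤⇒/<⌈/⌉ d d∤j)))
                   (s≤s (sum-mono λ i → ≤-/ d (da≤n i))))
  ...   | inj₂ (j , exc) with bounds (suc d)
  -- All sizes are `d` or `suc d`, so `n j ≤ suc d * a j ≤ suc d * (n j / d)`, against (ii).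
  ...     | inj₁ n≤ = <⇒≱ (exceeds⇒< (n j / d) (n>0 j) exc)
    (≤-trans (n≤ j) (≤-trans (*-monoʳ-≤ (suc d) (≤-/ d (da≤n j)))
                             (≤-reflexive (cong (_* (n j / d)) (+-comm 1 d)))))
  ...     | inj₂ ≤n =
    n≮n _ (≤-trans (subst (2 + sum (λ i → n i / suc d) ≤_) Σ≡
                     (sum-strict₂ (λ i → <⇒≤ (lt i)) zero (suc zero) (λ ()) (lt zero) (lt (suc zero))))
                   (s≤s (sum-mono λ i → ≤-/ (suc d) (≤n i))))
    where
    lt : ∀ i → n i / suc d < ⌈ n i / d ⌉
    lt i = /suc<⌈/⌉ d (n>0 i)

  -- The search runs over `d = suc e`, which keeps `d` nonzero. It ends by `d = suc (n zero)`, where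
  -- `n zero / d` is 0 and (ii) holds.
  least-alternative : ∃[ e ] IsMinimum (λ e → Alternative (suc e)) e
  least-alternative = least (λ e → alternative? (suc e)) (n zero)
    (inj₂ (zero , <⇒exceeds (n zero / suc (n zero))
      (subst (λ z → (suc (n zero) + 1) * z < n zero) (sym (m<n⇒m/n≡0 (n<1+n (n zero))))
        (subst (_< n zero) (sym (*-zeroʳ (suc (n zero) + 1))) (n>0 zero)))))

  is-p-threshold : ∃[ p ] (Is-p n (sum n) p × IsEquitableChromaticThreshold (completeMultipartite n) p)
  is-p-threshold with e , alt , min ← least-alternative =
      p
    , record
        { q≢0       = N≢0
        -- The case of singleton classes; no positive `d` is at most 0, so nothing has to be
        -- excluded.
        ; colorable = colorable zero (λ d d≤0 → ⊥-elim (<⇒≱ (>-nonZero⁻¹ d) d≤0)) (sum n)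
                        (≤-reflexive (sum-⌈/1⌉ n))
        ; d         = suc e
        -- For `q = sum n` the ceiling is 1, so it bounds every positive `d` from below.
        ; minimum   = record { lowerBound  = ⌈/⌉-≤ (sum n) {{N≢0}} (m≤m*n (sum n) (suc e))
                             ; alternative = alt }
                    , d-min
        ; value     = refl
        }
    , (≤-trans (pos zero) (term≤sum (λ i → ⌈ n i / suc e ⌉) zero)
      , colorable e below)
    , λ p′ (_ , all) → ≮⇒≥ λ p′<p → refute p′ all p′<p
    where
    p = sum (λ i → ⌈ n i / suc e ⌉)
    N≢0 : NonZero (sum n)
    N≢0 = >-nonZero (≤-trans (n>0 zero) (term≤sum n zero))
    pos : ∀ i → 0 < ⌈ n i / suc e ⌉
    pos i = ≤-trans (s≤s z≤n) (/suc<⌈/⌉ (suc e) (n>0 i))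
    d-min : ∀ d → Admissible n (sum n) {{N≢0}} d → suc e ≤ d
    d-min zero    record { d≢0 = () }
    d-min (suc d) adm = s≤s (min d (Admissible.alternative {{N≢0}} adm))
    below : ∀ d .{{_ : NonZero d}} → d ≤ e → ¬ Alternative d
    below (suc d) d<e alt′ = <⇒≱ d<e (min d alt′)
    refute : ∀ p′ → (∀ q → p′ ≤ q → EquitableColoring (completeMultipartite n) q) → p′ < p → ⊥
    refute p′ all p′<p with p in eq
    -- A threshold `p′ < p` would include `q = p − 1`, which `uncolorable` rules out.
    refute p′ all (s≤s p′≤q) | suc q = uncolorable (suc e) alt q eq (all q p′≤q)

mainTheorem2 : ∀ (k : ℕ) → 2 ≤ k → (n : Fin k → ℕ) → (∀ i → 0 < n i) →
    ∃[ p ] (Is-p n (sum n) p × IsEquitableChromaticThreshold (completeMultipartite n) p)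
mainTheorem2 (suc (suc k)) _ n n>0 = is-p-threshold n n>0
mainTheorem2 1 (s≤s ()) n n>0
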